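{- Let $G_0$, $G_1$ and $G_2$ be any three finite simple connected graphs, and let $\epsilon(G_0\vee(G_1\cup G_2))$ be the eccentricity matrix of the join of $G_0$ with the disjoint union of $G_1$ and $G_2$. 1. If $G_0$ is self-centered and $\mathrm{diam}(G_0)=2$, then $\epsilon(G_0\vee(G_1\cup G_2))$ is reducible. 2. If $G_0$ is not self-centered and $\mathrm{diam}(G_0)=2$, then $\epsilon(G_0\vee(G_1\cup G_2))$ is irreducible. 3. If $\mathrm{diam}(G_0)\ge 3$, then $\epsilon(G_0\vee(G_1\cup G_2))$ is reducible.
   Context: All graphs are finite, simple and undirected. $G\cup H$ denotes the disjoint union of $G$ and $H$, and the join $G\vee H$ is obtained from $G\cup H$ by joining every vertex of $G$ to every vertex of $H$. For a connected graph $G$ with distance function $d$, the eccentricity of a vertex $v$ is $e(v)=\max\{d(v,u):u\in V(G)\}$; the radius and diameter $\mathrm{diam}(G)$ are the minimum and maximum vertex eccentricities, and $G$ is self-centered if its radius equals its diameter. The eccentricity matrix $\epsilon(G)$ is the symmetric matrix indexed by $V(G)$ with $(u,v)$ entry $d(u,v)$ if $d(u,v)=\min\{e(u),e(v)\}$, and $0$ otherwise. A square matrix $N$ is reducible if there is a permutation matrix $P$ with $N=P^T\begin{pmatrix}A&B\\0&C\end{pmatrix}P$, where $A$ and $C$ are (nonempty) square blocks; it is irreducible otherwise. -}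

module Defs where

open import Data.Fin using (Fin; splitAt; _↑ˡ_; _↑ʳ_)
open import Data.Fin.Permutation using (Permutation; _⟨$⟩ʳ_)
open import Data.Fin.Properties using (any?; splitAt-↑ˡ; splitAt-↑ʳ) renaming (_≟_ to _≟ᶠ_)
open import Data.Integer as ℤ using (ℤ; +_; 0ℤ; 1ℤ)
open import Data.Integer.Properties using (+-*-semiring)
open import Data.List using (allFin; map)
open import Data.List.Extrema.Nat using (max; min)
open import Data.Nat using (ℕ; zero; suc; _+_; _≤_; z≤n; s≤s; _⊓_; _≟_)
open import Data.Product using (∃; Σ-syntax; ∃-syntax; _×_; _,_; proj₁)
open import Data.Sum using (_⊎_; inj₁; inj₂)
open import Data.Empty using (⊥)
open import Data.Unit using (⊤; tt)
open import Data.Vec.Functional using (_++_; zipWith; replicate; transpose)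
open import Function using (_∘_)
open import Relation.Binary using (Rel; Decidable; Symmetric)
open import Relation.Binary.PropositionalEquality using (_≡_; refl)
open import Relation.Nullary using (¬_; Dec; yes; no; does; contradiction)
open import Relation.Nullary.Decidable using (map′; _×-dec_)
open import Relation.Unary using (Pred) renaming (Decidable to Decidable₁)
open import Data.Bool using (if_then_else_)
open import Level using (0ℓ)

import Algebra.Properties.Semiring.Sum +-*-semiring as Σℤ

------------------------------------------------------------------------
-- Graphs

record Graph (n : ℕ) : Set₁ where
  field
    Adj     : Rel (Fin n) 0ℓ
    adj?    : Decidable Adj
    adj-sym : Symmetric Adj
    irrefl  : ∀ {u} → ¬ Adj u u

open Graph

private
  variable
    m n : ℕ

SumAdj : Set → Rel (Fin m) 0ℓ → Rel (Fin n) 0ℓ → Rel (Fin m ⊎ Fin n) 0ℓ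
SumAdj C R S (inj₁ u) (inj₁ v) = R u v
SumAdj C R S (inj₁ u) (inj₂ v) = C
SumAdj C R S (inj₂ u) (inj₁ v) = C
SumAdj C R S (inj₂ u) (inj₂ v) = S u v

-- The first m vertices carry G, the last n carry H, and two vertices from
-- different parts are adjacent exactly when C holds.
combine : (C : Set) → Dec C → Graph m → Graph n → Graph (m + n)
combine {m} {n} C C? G H = record
  { Adj     = λ x y → SumAdj C (Adj G) (Adj H) (splitAt m x) (splitAt m y)
  ; adj?    = λ x y → dec (splitAt m x) (splitAt m y)
  ; adj-sym = λ {x} {y} → symm (splitAt m x) (splitAt m y)
  ; irrefl  = λ {x} → irr (splitAt m x)
  }
  where
  dec : Decidable (SumAdj C (Adj G) (Adj H))
  dec (inj₁ u) (inj₁ v) = adj? G u v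
  dec (inj₁ u) (inj₂ v) = C?
  dec (inj₂ u) (inj₁ v) = C?
  dec (inj₂ u) (inj₂ v) = adj? H u v

  symm : ∀ x y → SumAdj C (Adj G) (Adj H) x y → SumAdj C (Adj G) (Adj H) y x
  symm (inj₁ u) (inj₁ v) a = adj-sym G a
  symm (inj₁ u) (inj₂ v) c = c
  symm (inj₂ u) (inj₁ v) c = c
  symm (inj₂ u) (inj₂ v) a = adj-sym H a

  irr : ∀ x → ¬ SumAdj C (Adj G) (Adj H) x x
  irr (inj₁ u) = irrefl G
  irr (inj₂ u) = irrefl H

infixr 6 _∪_
infixr 5 _∨_

_∪_ : Graph m → Graph n → Graph (m + n)
_∪_ = combine ⊥ (no λ ())

_∨_ : Graph m → Graph n → Graph (m + n)
_∨_ = combine ⊤ (yes tt)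

------------------------------------------------------------------------
-- Walks, connectedness and distance

data Walk (G : Graph n) : ℕ → Rel (Fin n) 0ℓ where
  []  : ∀ {u} → Walk G zero u u
  _∷_ : ∀ {k u v w} → Adj G u v → Walk G k v w → Walk G (suc k) u w

walk? : (G : Graph n) (k : ℕ) → Decidable (Walk G k)
walk? G zero    u w = map′ (λ { refl → [] }) (λ { [] → refl }) (u ≟ᶠ w)
walk? G (suc k) u w =
  map′ (λ { (_ , a , p) → a ∷ p }) (λ { (a ∷ p) → _ , a , p })
       (any? λ v → adj? G u v ×-dec walk? G k v w)

-- A connected graph is nonempty.
record Connected (G : Graph n) : Set where
  field
    vertex : Fin n
    joined : ∀ u v → ∃[ k ] Walk G k u v

open Connected

∨-connected : (G : Graph m) (H : Graph n) → Fin m → Fin n → Connected (G ∨ H)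
∨-connected {m} {n} G H g h = record
  { vertex = g ↑ˡ n
  ; joined = λ x y → go x y (splitAt m x) refl (splitAt m y) refl
  }
  where
  J : Rel (Fin m ⊎ Fin n) 0ℓ
  J = SumAdj ⊤ (Adj G) (Adj H)

  edge : ∀ {x y s t} → splitAt m x ≡ s → splitAt m y ≡ t → J s t → Adj (G ∨ H) x y
  edge refl refl a = a

  atG : splitAt m (g ↑ˡ n) ≡ inj₁ g
  atG = splitAt-↑ˡ m g n

  atH : splitAt m (m ↑ʳ h) ≡ inj₂ h
  atH = splitAt-↑ʳ m n h

  go : ∀ x y s → splitAt m x ≡ s → ∀ t → splitAt m y ≡ t → ∃[ k ] Walk (G ∨ H) k x y
  go x y (inj₁ _) p (inj₁ _) q = 2 , edge p atH tt ∷ (edge atH q tt ∷ [])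
  go x y (inj₁ _) p (inj₂ _) q = 1 , edge p q tt ∷ []
  go x y (inj₂ _) p (inj₁ _) q = 1 , edge p q tt ∷ []
  go x y (inj₂ _) p (inj₂ _) q = 2 , edge p atG tt ∷ (edge atG q tt ∷ [])

least : {P : Pred ℕ 0ℓ} → Decidable₁ P → ∀ b → P b →
        ∃[ k ] P k × (∀ j → P j → k ≤ j)
least P? zero    p = zero , p , λ _ _ → z≤n
least P? (suc b) p with P? zero
... | yes p₀ = zero , p₀ , λ _ _ → z≤n
... | no ¬p₀ =
  let k , q , below = least (P? ∘ suc) b p
  in  suc k , q , λ { zero p₀ → contradiction p₀ ¬p₀ ; (suc j) r → s≤s (below j r) }

shortest : {G : Graph n} → Connected G → ∀ u v →
           ∃[ k ] Walk G k u v × (∀ j → Walk G j u v → k ≤ j)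
shortest {G = G} c u v =
  let b , p = joined c u v in least (λ k → walk? G k u v) b p

module _ {G : Graph n} (c : Connected G) where

  dist : Fin n → Fin n → ℕ
  dist u v = proj₁ (shortest c u v)

  ecc : Fin n → ℕ
  ecc v = max 0 (map (dist v) (allFin n))

  diam : ℕ
  diam = max 0 (map ecc (allFin n))

  radius : ℕ
  radius = min (ecc (vertex c)) (map ecc (allFin n))

  SelfCentered : Set
  SelfCentered = radius ≡ diam

------------------------------------------------------------------------
-- Matrices

Matrix : ℕ → ℕ → Set
Matrix m n = Fin m → Fin n → ℤ

infixl 7 _·_

_·_ : ∀ {k} → Matrix m k → Matrix k n → Matrix m n
(M · N) i j = Σℤ.sum λ l → M i l ℤ.* N l j

blockUpper : ∀ {k l} → Matrix k k → Matrix k l → Matrix l l → Matrix (k + l) (k + l)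
blockUpper {k} A B C = zipWith _++_ A B ++ λ i → replicate k 0ℤ ++ C i

permMatrix : Permutation m n → Matrix m n
permMatrix π i j = if does (π ⟨$⟩ʳ i ≟ᶠ j) then 1ℤ else 0ℤ

-- A bijection π : Fin (suc k + suc l) ↔ Fin n forces n ≡ suc k + suc l, so P is
-- square; the indices suc k and suc l make both diagonal blocks nonempty.
Reducible : Matrix n n → Set
Reducible {n} N =
  ∃[ k ] ∃[ l ]
  Σ[ π ∈ Permutation (suc k + suc l) n ]
  Σ[ A ∈ Matrix (suc k) (suc k) ]
  Σ[ B ∈ Matrix (suc k) (suc l) ]
  Σ[ C ∈ Matrix (suc l) (suc l) ]
    (let P = permMatrix π in
     ∀ i j → N i j ≡ (transpose P · blockUpper A B C · P) i j)

Irreducible : Matrix n n → Set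
Irreducible N = ¬ Reducible N

ε : {G : Graph n} → Connected G → Matrix n n
ε c u v =
  if does (dist c u v ≟ ecc c u ⊓ ecc c v) then + dist c u v else 0ℤ

------------------------------------------------------------------------
-- The graph G₀ ∨ (G₁ ∪ G₂)

join-connected : ∀ {n₀ n₁ n₂} {G₀ : Graph n₀} {G₁ : Graph n₁} {G₂ : Graph n₂} →
                 Connected G₀ → Connected G₁ → Connected G₂ → Connected (G₀ ∨ (G₁ ∪ G₂))
join-connected {n₂ = n₂} {G₀} {G₁} {G₂} c₀ c₁ _ =
  ∨-connected G₀ (G₁ ∪ G₂) (vertex c₀) (vertex c₁ ↑ˡ n₂)

{-# OPTIONS --safe #-}
-- In J = G₀ ∨ (G₁ ∪ G₂) a vertex has eccentricity 1 if it is dominating (adjacent to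
-- all others) and 2 otherwise, and no vertex of G₁ ∪ G₂ is dominating.  If G₀ has no
-- dominating vertex, then every entry of ε(J) between G₀ and G₁ ∪ G₂ is at distance 1
-- with both eccentricities ≥ 2, hence is 0, and ε(J) is block diagonal.  If G₀ has a
-- dominating vertex, its row and column in ε(J) are nonzero off the diagonal, which no
-- zero block can accommodate.  When diam G₀ = 2 a dominating vertex exists exactly if
-- G₀ is not self-centered, and when diam G₀ ≥ 3 there is none.
module Submission where

open import Defs
open import Data.Bool using (if_then_else_)
open import Data.Fin using (Fin; zero; splitAt; join; punchIn; _↑ˡ_; _↑ʳ_)
open import Data.Fin.Permutation using (Permutation; _⟨$⟩ʳ_; _⟨$⟩ˡ_; inverseˡ; inverseʳ)
  renaming (id to idₚ)
open import Data.Fin.Properties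
  using (any?; splitAt-join; join-splitAt; punchInᵢ≢i) renaming (_≟_ to _≟ᶠ_)
open import Data.Integer as ℤ using (ℤ; +_; 0ℤ; 1ℤ)
open import Data.Integer.Properties as ℤ using (+-*-semiring)
open import Data.List using (allFin; map)
open import Data.List.Extrema.Nat using (max≤v⁺; v≤max⁺; min≤v⁺; v≤min⁺)
open import Data.List.Membership.Propositional.Properties using (∈-allFin; ∈-map⁺)
open import Data.List.Relation.Unary.All using (universal)
open import Data.List.Relation.Unary.All.Properties using (map⁺)
open import Data.List.Relation.Unary.Any as Any using ()
open import Data.Nat using (ℕ; suc; _+_; _≤_; z≤n; s≤s; _⊓_; _≟_; _≤?_)
open import Data.Nat.Properties
  using (≤-trans; ≤-antisym; ≤-reflexive; ≰⇒>; <⇒≱; ⊓-glb; m⊓n≤m; m⊓n≤n)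
open import Data.Product using (∃; _×_; _,_; proj₁; proj₂)
open import Data.Sum using (_⊎_; inj₁; inj₂; [_,_])
open import Data.Unit using (tt)
open import Data.Vec.Functional using (transpose; zipWith; replicate) renaming (_++_ to _++ᵛ_)
open import Data.Vec.Functional.Properties using (lookup-++ˡ; lookup-++ʳ)
open import Function using (_∘_; case_of_)
open import Relation.Binary.PropositionalEquality
  using (_≡_; _≢_; refl; sym; trans; cong; cong₂; cong-app; subst; module ≡-Reasoning)
open import Relation.Nullary using (¬_; Dec; yes; no; contradiction)
open import Relation.Nullary.Decidable using (dec-true; dec-false)
open import Algebra.Properties.Semiring.Sum +-*-semiring
  using (sum; sum-remove; sum-cong-≗; sum-replicate-zero)

open Graph
open Connected
open ≡-Reasoning

private
  variable
    k m n : ℕ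

-- Matrices

sum-single : (f : Fin n → ℤ) (i : Fin n) → (∀ j → j ≢ i → f j ≡ 0ℤ) → sum f ≡ f i
sum-single {suc n} f i vanish = begin
  sum f                                  ≡⟨ sum-remove {i = i} f ⟩
  f i ℤ.+ sum (λ j → f (punchIn i j))    ≡⟨ cong (λ x → f i ℤ.+ x) (sum-cong-≗ λ j → vanish _ (punchInᵢ≢i i j)) ⟩
  f i ℤ.+ sum {n} (replicate n 0ℤ)       ≡⟨ cong (λ x → f i ℤ.+ x) (sum-replicate-zero n) ⟩
  f i ℤ.+ 0ℤ                             ≡⟨ ℤ.+-identityʳ (f i) ⟩
  f i                                    ∎

permMatrix-preimage : (π : Permutation m n) → ∀ j → permMatrix π (π ⟨$⟩ˡ j) j ≡ 1ℤ
permMatrix-preimage π j =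
  cong (if_then 1ℤ else 0ℤ) (dec-true (π ⟨$⟩ʳ (π ⟨$⟩ˡ j) ≟ᶠ j) (inverseʳ π))

permMatrix-zero : (π : Permutation m n) → ∀ {i} j → i ≢ π ⟨$⟩ˡ j → permMatrix π i j ≡ 0ℤ
permMatrix-zero π {i} j i≢ =
  cong (if_then 1ℤ else 0ℤ) (dec-false (π ⟨$⟩ʳ i ≟ᶠ j) λ { refl → i≢ (sym (inverseˡ π)) })

-- Column `j` of the permutation matrix has its only 1 in the row that `π` sends to `j`, so one
-- summand of the product survives.
·-permMatrix : (X : Matrix k m) (π : Permutation m n) →
               ∀ i j → (X · permMatrix π) i j ≡ X i (π ⟨$⟩ˡ j)
·-permMatrix X π i j = begin
  (X · permMatrix π) i j                            ≡⟨ sum-single _ (π ⟨$⟩ˡ j) off ⟩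
  X i (π ⟨$⟩ˡ j) ℤ.* permMatrix π (π ⟨$⟩ˡ j) j      ≡⟨ cong (X i _ ℤ.*_) (permMatrix-preimage π j) ⟩
  X i (π ⟨$⟩ˡ j) ℤ.* 1ℤ                             ≡⟨ ℤ.*-identityʳ _ ⟩
  X i (π ⟨$⟩ˡ j)                                    ∎
  where
  off : ∀ l → l ≢ π ⟨$⟩ˡ j → X i l ℤ.* permMatrix π l j ≡ 0ℤ
  off l l≢ = trans (cong (X i l ℤ.*_) (permMatrix-zero π j l≢)) (ℤ.*-zeroʳ (X i l))

permMatrixᵀ-· : (π : Permutation m n) (X : Matrix m k) →
                ∀ i j → (transpose (permMatrix π) · X) i j ≡ X (π ⟨$⟩ˡ i) j
permMatrixᵀ-· π X i j = begin
  (transpose (permMatrix π) · X) i j                ≡⟨ sum-single _ (π ⟨$⟩ˡ i) off ⟩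
  permMatrix π (π ⟨$⟩ˡ i) i ℤ.* X (π ⟨$⟩ˡ i) j      ≡⟨ cong (ℤ._* X (π ⟨$⟩ˡ i) j) (permMatrix-preimage π i) ⟩
  1ℤ ℤ.* X (π ⟨$⟩ˡ i) j                             ≡⟨ ℤ.*-identityˡ _ ⟩
  X (π ⟨$⟩ˡ i) j                                    ∎
  where
  off : ∀ l → l ≢ π ⟨$⟩ˡ i → permMatrix π l i ℤ.* X l j ≡ 0ℤ
  off l l≢ = trans (cong (ℤ._* X l j) (permMatrix-zero π i l≢)) (ℤ.*-zeroˡ (X l j))

-- This removes the matrix products from `Reducible`: conjugation only relabels rows and columns, so
-- reducibility becomes a statement about single entries.
permMatrix-conj : (π : Permutation m n) (X : Matrix m m) → ∀ i j →
                  (transpose (permMatrix π) · X · permMatrix π) i j ≡ X (π ⟨$⟩ˡ i) (π ⟨$⟩ˡ j)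
permMatrix-conj π X i j =
  trans (·-permMatrix (transpose (permMatrix π) · X) π i j) (permMatrixᵀ-· π X i _)

-- Block triangular form and reducibility.

module _ (A : Matrix m m) (B : Matrix m n) (C : Matrix n n) where

  -- Indexing by a disjoint sum lets the block of an entry be found by pattern matching.
  blockEntry : Fin m ⊎ Fin n → Fin m ⊎ Fin n → ℤ
  blockEntry (inj₁ i) (inj₁ j) = A i j
  blockEntry (inj₁ i) (inj₂ j) = B i j
  blockEntry (inj₂ i) (inj₁ j) = 0ℤ
  blockEntry (inj₂ i) (inj₂ j) = C i j

  blockUpper-join : ∀ s t → blockUpper A B C (join m n s) (join m n t) ≡ blockEntry s t
  blockUpper-join (inj₁ i) t =
    trans (cong-app (lookup-++ˡ (zipWith _++ᵛ_ A B) (λ i → replicate m 0ℤ ++ᵛ C i) i) (join m n t)) (entry t)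
    where
    entry : ∀ t → (A i ++ᵛ B i) (join m n t) ≡ blockEntry (inj₁ i) t
    entry (inj₁ j) = lookup-++ˡ (A i) (B i) j
    entry (inj₂ j) = lookup-++ʳ (A i) (B i) j
  blockUpper-join (inj₂ i) t =
    trans (cong-app (lookup-++ʳ (zipWith _++ᵛ_ A B) (λ i → replicate m 0ℤ ++ᵛ C i) i) (join m n t)) (entry t)
    where
    entry : ∀ t → (replicate m 0ℤ ++ᵛ C i) (join m n t) ≡ blockEntry (inj₂ i) t
    entry (inj₁ j) = lookup-++ˡ (replicate m 0ℤ) (C i) j
    entry (inj₂ j) = lookup-++ʳ (replicate m 0ℤ) (C i) j

-- The zero block already lies at the lower left, so the identity permutation serves. The elements
-- of `Fin m` and `Fin n` force both sizes to be successors, as nonempty diagonal blocks require.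
zeroBlock⇒Reducible : (N : Matrix (m + n) (m + n)) → Fin m → Fin n →
                      (∀ i j → N (m ↑ʳ i) (j ↑ˡ n) ≡ 0ℤ) → Reducible N
zeroBlock⇒Reducible {suc k} {suc l} N _ _ N≡0 =
  k , l , idₚ , A , B , C , λ i j → sym (begin
    (transpose (permMatrix idₚ) · blockUpper A B C · permMatrix idₚ) i j  ≡⟨ permMatrix-conj idₚ (blockUpper A B C) i j ⟩
    blockUpper A B C i j                                              ≡⟨ cong₂ (blockUpper A B C) (rejoin i) (rejoin j) ⟨
    blockUpper A B C (rejoined i) (rejoined j)                          ≡⟨ blockUpper-join A B C (splitAt (suc k) i) (splitAt (suc k) j) ⟩
    blockEntry A B C (splitAt (suc k) i) (splitAt (suc k) j)          ≡⟨ blocks (splitAt (suc k) i) (splitAt (suc k) j) ⟩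
    N (rejoined i) (rejoined j)                                         ≡⟨ cong₂ N (rejoin i) (rejoin j) ⟩
    N i j                                                             ∎)
  where
  A : Matrix (suc k) (suc k)
  A i j = N (i ↑ˡ suc l) (j ↑ˡ suc l)

  B : Matrix (suc k) (suc l)
  B i j = N (i ↑ˡ suc l) (suc k ↑ʳ j)

  C : Matrix (suc l) (suc l)
  C i j = N (suc k ↑ʳ i) (suc k ↑ʳ j)

  rejoined : Fin (suc k + suc l) → Fin (suc k + suc l)
  rejoined i = join (suc k) (suc l) (splitAt (suc k) i)

  rejoin : ∀ i → rejoined i ≡ i
  rejoin = join-splitAt (suc k) (suc l)

  blocks : ∀ s t → blockEntry A B C s t ≡ N (join (suc k) (suc l) s) (join (suc k) (suc l) t)
  blocks (inj₁ i) (inj₁ j) = refl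
  blocks (inj₁ i) (inj₂ j) = refl
  blocks (inj₂ i) (inj₁ j) = sym (N≡0 i j)
  blocks (inj₂ i) (inj₂ j) = refl

-- In a block triangular form `u` falls into one of the two blocks. In the first its column crosses
-- the zero block, in the second its row does, and either way a nonzero off-diagonal entry would
-- have to vanish.
nonzeroCross⇒Irreducible : (N : Matrix n n) (u : Fin n) →
                           (∀ v → u ≢ v → N u v ≢ 0ℤ × N v u ≢ 0ℤ) → Irreducible N
nonzeroCross⇒Irreducible {n} N u N≢0 (k , l , π , A , B , C , eq) =
  go (splitAt (suc k) (π ⟨$⟩ˡ u)) (begin
    π ⟨$⟩ʳ join (suc k) (suc l) (splitAt (suc k) (π ⟨$⟩ˡ u))  ≡⟨ cong (π ⟨$⟩ʳ_) (join-splitAt (suc k) (suc l) _) ⟩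
    π ⟨$⟩ʳ (π ⟨$⟩ˡ u)                                         ≡⟨ inverseʳ π ⟩
    u                                                         ∎)
  where
  at : Fin (suc k) ⊎ Fin (suc l) → Fin n
  at s = π ⟨$⟩ʳ join (suc k) (suc l) s

  -- Positions in different blocks thus give different indices, so the entry compared with 0 is off
  -- the diagonal of `N`.
  at-injective : ∀ s t → at s ≡ at t → s ≡ t
  at-injective s t p = begin
    s                                                                   ≡⟨ back s ⟨
    splitAt (suc k) (π ⟨$⟩ˡ at s)                                       ≡⟨ cong (λ x → splitAt (suc k) (π ⟨$⟩ˡ x)) p ⟩
    splitAt (suc k) (π ⟨$⟩ˡ at t)                                       ≡⟨ back t ⟩
    t                                                                   ∎
    where
    back : ∀ s → splitAt (suc k) (π ⟨$⟩ˡ at s) ≡ s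
    back s = trans (cong (splitAt (suc k)) (inverseˡ π)) (splitAt-join (suc k) (suc l) s)

  lowerLeft : ∀ i j → N (at (inj₂ i)) (at (inj₁ j)) ≡ 0ℤ
  lowerLeft i j = begin
    N (at (inj₂ i)) (at (inj₁ j))                                             ≡⟨ eq _ _ ⟩
    _                                                                         ≡⟨ permMatrix-conj π (blockUpper A B C) _ _ ⟩
    blockUpper A B C (π ⟨$⟩ˡ at (inj₂ i)) (π ⟨$⟩ˡ at (inj₁ j))                ≡⟨ cong₂ (blockUpper A B C) (inverseˡ π) (inverseˡ π) ⟩
    blockUpper A B C (suc k ↑ʳ i) (j ↑ˡ suc l)                                ≡⟨ blockUpper-join A B C (inj₂ i) (inj₁ j) ⟩
    0ℤ                                                                        ∎

  go : ∀ s → at s ≢ u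
  -- The opposite block has successor size, so its position `zero` is available as the partner of
  -- `u`.
  go (inj₁ i) refl = proj₂ (N≢0 (at (inj₂ zero)) (λ p → case at-injective (inj₁ i) (inj₂ zero) p of λ ())) (lowerLeft zero i)
  go (inj₂ i) refl = proj₁ (N≢0 (at (inj₁ zero)) (λ p → case at-injective (inj₂ i) (inj₁ zero) p of λ ())) (lowerLeft i zero)

-- Dominating vertices and eccentricity

-- Corresponds to eccentricity at most 1, not exactly 1: the vertex of a one-vertex graph also
-- qualifies.
Dominating : Graph n → Fin n → Set
Dominating G u = ∀ v → u ≡ v ⊎ Adj G u v

module _ {G : Graph n} (c : Connected G) where

  dist-walk : ∀ u v → Walk G (dist c u v) u v
  dist-walk u v = proj₁ (proj₂ (shortest c u v))

  dist≤length : ∀ {u v} → Walk G k u v → dist c u v ≤ k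
  dist≤length {u = u} {v} = proj₂ (proj₂ (shortest c u v)) _

  dist≤ecc : ∀ u v → dist c u v ≤ ecc c u
  dist≤ecc u v = v≤max⁺ 0 (map (dist c u) (allFin n))
    (inj₂ (Any.map ≤-reflexive (∈-map⁺ (dist c u) (∈-allFin v))))

  ecc≤ : ∀ {u b} → (∀ v → dist c u v ≤ b) → ecc c u ≤ b
  ecc≤ d≤b = max≤v⁺ z≤n (map⁺ (universal d≤b (allFin n)))

  ecc≤diam : ∀ u → ecc c u ≤ diam c
  ecc≤diam u = v≤max⁺ 0 (map (ecc c) (allFin n))
    (inj₂ (Any.map ≤-reflexive (∈-map⁺ (ecc c) (∈-allFin u))))

  diam≤ : ∀ {b} → (∀ u → ecc c u ≤ b) → diam c ≤ b
  diam≤ e≤b = max≤v⁺ z≤n (map⁺ (universal e≤b (allFin n)))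

  radius≤ecc : ∀ u → radius c ≤ ecc c u
  radius≤ecc u = min≤v⁺ (ecc c (vertex c)) (map (ecc c) (allFin n))
    (inj₂ (Any.map (≤-reflexive ∘ sym) (∈-map⁺ (ecc c) (∈-allFin u))))

  ≤radius : ∀ {b} → (∀ u → b ≤ ecc c u) → b ≤ radius c
  -- The default value of `min` in `radius` is the eccentricity of the chosen vertex, so the bound
  -- is needed there as well as along the list.
  ≤radius b≤e = v≤min⁺ (b≤e (vertex c)) (map⁺ (universal b≤e (allFin n)))

  walk≤1 : ∀ {u v} → Walk G k u v → k ≤ 1 → u ≡ v ⊎ Adj G u v
  walk≤1 []            _        = inj₁ refl
  walk≤1 (a ∷ [])      _        = inj₂ a
  walk≤1 (_ ∷ (_ ∷ _)) (s≤s ())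

  -- The edge is a walk of length 1, and irreflexivity rules out length 0.
  dist-adj : ∀ {u v} → Adj G u v → dist c u v ≡ 1
  dist-adj {u} {v} a = ≤-antisym (dist≤length (a ∷ [])) (positive (dist-walk u v))
    where
    positive : Walk G k u v → 1 ≤ k
    positive []      = contradiction a (irrefl G)
    positive (_ ∷ _) = s≤s z≤n

  ecc≤1⇒Dominating : ∀ {u} → ecc c u ≤ 1 → Dominating G u
  ecc≤1⇒Dominating {u} e≤1 v = walk≤1 (dist-walk u v) (≤-trans (dist≤ecc u v) e≤1)

  Dominating⇒ecc≤1 : ∀ {u} → Dominating G u → ecc c u ≤ 1
  Dominating⇒ecc≤1 {u} dom = ecc≤ λ v →
    [ (λ { refl → ≤-trans (dist≤length []) z≤n }) , (λ a → dist≤length (a ∷ [])) ] (dom v)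

  ¬Dominating⇒2≤ecc : ∀ {u} → ¬ Dominating G u → 2 ≤ ecc c u
  ¬Dominating⇒2≤ecc ¬dom = ≰⇒> (¬dom ∘ ecc≤1⇒Dominating)

  -- Any two vertices are linked by a walk through `u` with at most two edges.
  Dominating⇒diam≤2 : ∀ {u} → Dominating G u → diam c ≤ 2
  Dominating⇒diam≤2 {u} dom = diam≤ λ x → ecc≤ λ y → via (dom x) (dom y)
    where
    via : ∀ {x y} → u ≡ x ⊎ Adj G u x → u ≡ y ⊎ Adj G u y → dist c x y ≤ 2
    via (inj₁ refl) (inj₁ refl) = ≤-trans (dist≤length []) z≤n
    via (inj₁ refl) (inj₂ b)    = ≤-trans (dist≤length (b ∷ [])) (s≤s z≤n)
    via (inj₂ a)    (inj₁ refl) = ≤-trans (dist≤length (adj-sym G a ∷ [])) (s≤s z≤n)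
    via (inj₂ a)    (inj₂ b)    = dist≤length (adj-sym G a ∷ (b ∷ []))

  -- A dominating vertex would bring the radius down to at most 1, whereas here it equals the
  -- diameter 2.
  SelfCentered⇒¬Dominating : SelfCentered c → diam c ≡ 2 → ∀ u → ¬ Dominating G u
  SelfCentered⇒¬Dominating r≡d d≡2 u dom =
    <⇒≱ (≤-reflexive (sym (trans r≡d d≡2))) (≤-trans (radius≤ecc u) (Dominating⇒ecc≤1 dom))

  -- A finite search for a vertex of eccentricity at most 1 yields the witness. If it fails, all
  -- eccentricities are at least 2, so the radius reaches the diameter 2 and the graph is
  -- self-centered.
  ¬SelfCentered⇒Dominating : ¬ SelfCentered c → diam c ≡ 2 → ∃ (Dominating G)
  ¬SelfCentered⇒Dominating r≢d d≡2 with any? (λ u → ecc c u ≤? 1)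
  ... | yes (u , e≤1) = u , ecc≤1⇒Dominating e≤1
  ... | no none = contradiction
    (≤-antisym (≤-trans (radius≤ecc (vertex c)) (ecc≤diam (vertex c)))
               (subst (_≤ radius c) (sym d≡2) (≤radius λ u → ≰⇒> λ e≤1 → none (u , e≤1))))
    r≢d

  -- The distance is 1, while both eccentricities are at least 2.
  ε-adj-¬Dominating : ∀ {u v} → Adj G u v → ¬ Dominating G u → ¬ Dominating G v → ε c u v ≡ 0ℤ
  ε-adj-¬Dominating {u} {v} a ¬du ¬dv =
    cong (if_then + dist c u v else 0ℤ) (dec-false (dist c u v ≟ ecc c u ⊓ ecc c v) λ d≡e →
      <⇒≱ (⊓-glb (¬Dominating⇒2≤ecc ¬du) (¬Dominating⇒2≤ecc ¬dv))
          (≤-reflexive (trans (sym d≡e) (dist-adj a))))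

  -- The edge makes both eccentricities at least 1 and the dominating endpoint has eccentricity at
  -- most 1, so their minimum equals the distance 1.
  ε-adj-Dominating : ∀ {u v} → Adj G u v → Dominating G u ⊎ Dominating G v → ε c u v ≡ 1ℤ
  ε-adj-Dominating {u} {v} a dom = begin
    ε c u v       ≡⟨ cong (if_then + dist c u v else 0ℤ) (dec-true (dist c u v ≟ ecc c u ⊓ ecc c v) d≡e) ⟩
    + dist c u v  ≡⟨ cong +_ (dist-adj a) ⟩
    1ℤ            ∎
    where
    1≤ecc : ∀ {x y} → Adj G x y → 1 ≤ ecc c x
    1≤ecc {x} {y} b = subst (_≤ ecc c x) (dist-adj b) (dist≤ecc x y)

    d≡e : dist c u v ≡ ecc c u ⊓ ecc c v
    d≡e = trans (dist-adj a) (≤-antisym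
      (⊓-glb (1≤ecc a) (1≤ecc (adj-sym G a)))
      ([ (λ du → ≤-trans (m⊓n≤m _ _) (Dominating⇒ecc≤1 du))
       , (λ dv → ≤-trans (m⊓n≤n (ecc c u) _) (Dominating⇒ecc≤1 dv)) ] dom))

  Dominating⇒Irreducible : ∀ {u} → Dominating G u → Irreducible (ε c)
  Dominating⇒Irreducible {u} dom = nonzeroCross⇒Irreducible (ε c) u λ v u≢v →
    case dom v of λ
      { (inj₁ u≡v) → contradiction u≡v u≢v
      ; (inj₂ a)   →
          (λ p → case trans (sym (ε-adj-Dominating a (inj₁ dom))) p of λ ())
        , (λ p → case trans (sym (ε-adj-Dominating (adj-sym G a) (inj₂ dom))) p of λ ())
      }

-- Joins and unions

module _ {C : Set} (C? : Dec C) (G : Graph m) (H : Graph n) where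

  -- An equality of types, along which adjacency proofs are transported between vertices of the
  -- combined graph and tagged vertices of its parts.
  combine-adj : ∀ s t → Adj (combine C C? G H) (join m n s) (join m n t) ≡
                        SumAdj C (Adj G) (Adj H) s t
  combine-adj s t = cong₂ (SumAdj C (Adj G) (Adj H)) (splitAt-join m n s) (splitAt-join m n t)

  combine-Dominating⁻ : ∀ s → Dominating (combine C C? G H) (join m n s) →
                        ∀ t → s ≡ t ⊎ SumAdj C (Adj G) (Adj H) s t
  combine-Dominating⁻ s dom t with dom (join m n t)
  ... | inj₁ p = inj₁ (trans (sym (splitAt-join m n s)) (trans (cong (splitAt m) p) (splitAt-join m n t)))
  ... | inj₂ a = inj₂ (subst (λ A → A) (combine-adj s t) a)

  combine-Dominating⁺ : ∀ s → (∀ t → s ≡ t ⊎ SumAdj C (Adj G) (Adj H) s t) →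
                        Dominating (combine C C? G H) (join m n s)
  combine-Dominating⁺ s dom x = subst (λ y → join m n s ≡ y ⊎ Adj (combine C C? G H) (join m n s) y)
    (join-splitAt m n x)
    ([ inj₁ ∘ cong (join m n) , inj₂ ∘ subst (λ A → A) (sym (combine-adj s _)) ] (dom (splitAt m x)))

module _ (G : Graph m) (H : Graph n) where

  ∨-adjʳˡ : ∀ h g → Adj (G ∨ H) (m ↑ʳ h) (g ↑ˡ n)
  ∨-adjʳˡ h g = subst (λ A → A) (sym (combine-adj (yes tt) G H (inj₂ h) (inj₁ g))) tt

  ∨-Dominatingˡ⁺ : ∀ {g} → Dominating G g → Dominating (G ∨ H) (g ↑ˡ n)
  ∨-Dominatingˡ⁺ {g} dom = combine-Dominating⁺ (yes tt) G H (inj₁ g) λ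
    { (inj₁ v) → [ inj₁ ∘ cong inj₁ , inj₂ ] (dom v)
    ; (inj₂ h) → inj₂ tt
    }

  ∨-Dominatingˡ⁻ : ∀ {g} → Dominating (G ∨ H) (g ↑ˡ n) → Dominating G g
  ∨-Dominatingˡ⁻ {g} dom v with combine-Dominating⁻ (yes tt) G H (inj₁ g) dom (inj₁ v)
  ... | inj₁ refl = inj₁ refl
  ... | inj₂ a    = inj₂ a

  ∨-Dominatingʳ⁻ : ∀ {h} → Dominating (G ∨ H) (m ↑ʳ h) → Dominating H h
  ∨-Dominatingʳ⁻ {h} dom v with combine-Dominating⁻ (yes tt) G H (inj₂ h) dom (inj₂ v)
  ... | inj₁ refl = inj₁ refl
  ... | inj₂ a    = inj₂ a

  -- Both parts are nonempty, and a vertex of one part is neither equal nor adjacent to a vertex of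
  -- the other.
  ∪-¬Dominating : Fin m → Fin n → ∀ x → ¬ Dominating (G ∪ H) x
  ∪-¬Dominating g h x dom =
    apart (splitAt m x)
      (combine-Dominating⁻ (no λ ()) G H (splitAt m x) (subst (Dominating (G ∪ H)) (sym (join-splitAt m n x)) dom))
    where
    apart : ∀ s → ¬ (∀ t → s ≡ t ⊎ SumAdj _ (Adj G) (Adj H) s t)
    apart (inj₁ _) d = [ (λ ()) , (λ ()) ] (d (inj₂ h))
    apart (inj₂ _) d = [ (λ ()) , (λ ()) ] (d (inj₁ g))

  ∨-¬Dominating⇒Reducible : (c : Connected (G ∨ H)) → Fin m → Fin n →
                            (∀ g → ¬ Dominating G g) → (∀ h → ¬ Dominating H h) → Reducible (ε c)
  ∨-¬Dominating⇒Reducible c g₀ h₀ ¬dG ¬dH = zeroBlock⇒Reducible (ε c) g₀ h₀ λ h g →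
    ε-adj-¬Dominating c (∨-adjʳˡ h g) (¬dH h ∘ ∨-Dominatingʳ⁻) (¬dG g ∘ ∨-Dominatingˡ⁻)

theorem4p9 : ∀ {n₀ n₁ n₂ : ℕ} (G₀ : Graph n₀) (G₁ : Graph n₁) (G₂ : Graph n₂) →
    (c₀ : Connected G₀) (c₁ : Connected G₁) (c₂ : Connected G₂) →
    let c : Connected (G₀ ∨ (G₁ ∪ G₂))
        c = join-connected c₀ c₁ c₂
    in (SelfCentered c₀ → diam c₀ ≡ 2 → Reducible (ε c))
     × (¬ SelfCentered c₀ → diam c₀ ≡ 2 → Irreducible (ε c))
     × (3 ≤ diam c₀ → Reducible (ε c))
theorem4p9 {n₂ = n₂} G₀ G₁ G₂ c₀ c₁ c₂ =
    (λ sc d≡2 → reducible (SelfCentered⇒¬Dominating c₀ sc d≡2))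
  , (λ ¬sc d≡2 → Dominating⇒Irreducible c
      (∨-Dominatingˡ⁺ G₀ (G₁ ∪ G₂) (proj₂ (¬SelfCentered⇒Dominating c₀ ¬sc d≡2))))
  -- A dominating vertex of `G₀` would bound its diameter by 2.
  , (λ 3≤d → reducible λ u dom → <⇒≱ 3≤d (Dominating⇒diam≤2 c₀ dom))
  where
  c : Connected (G₀ ∨ (G₁ ∪ G₂))
  c = join-connected c₀ c₁ c₂

  reducible : (∀ u → ¬ Dominating G₀ u) → Reducible (ε c)
  reducible ¬dom = ∨-¬Dominating⇒Reducible G₀ (G₁ ∪ G₂) c (vertex c₀) (vertex c₁ ↑ˡ n₂) ¬dom
    (∪-¬Dominating G₁ G₂ (vertex c₁) (vertex c₂))
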